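{- (i) $\bar{R}(3,3,3)=\bar{R}(4,3,3)=\bar{R}(5,3,3)=5$ and $\bar{R}(6,3,3)=6$. (ii) $\bar{R}(4,4,3)=7$, $\bar{R}(5,4,3)=\bar{R}(6,4,3)=8$, and $\bar{R}(7,4,3)=9$. (iii) $\bar{R}(4,4,4)=10$.
   Context: For a positive integer $n$, $[n]=\{1,\dots,n\}$. An edge-coloring of $K_n$ with $k$ colors is a map $f:\binom{[n]}{2}\to[k]$; for $i\in[k]$, $\alpha_i(f)$ is the independence number of the graph on $[n]$ whose edges are the pairs of color $i$. For positive integers $m_1,\dots,m_k$, the complementary Ramsey number $\bar{R}(m_1,\dots,m_k)$ is the least positive integer $n$ such that for every edge-coloring $f$ of $K_n$ with $k$ colors there exists $i\in[k]$ with $\alpha_i(f)\ge m_i$. -}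

module Defs where

open import Data.Nat using (ℕ; _≤_; _<_)
open import Data.Fin using (Fin) renaming (_<_ to _<ᶠ_)
open import Data.Fin.Subset using (Subset; _∈_; ∣_∣)
open import Data.Vec using (Vec; lookup)
open import Data.Product using (Σ; _×_)
open import Relation.Binary.PropositionalEquality using (_≡_)
open import Relation.Nullary using (¬_)

-- An edge-colouring of K_n with k colours. The edge {i,j} with i < j
-- receives colour  f i j ; values f i j with i ≥ j are ignored, so these
-- functions represent exactly the maps  binom([n],2) → [k].
Coloring : ℕ → ℕ → Set
Coloring n k = Fin n → Fin n → Fin k

IsIndependent : ∀ {n k} → Coloring n k → Fin k → Subset n → Set
IsIndependent f c S =
  ∀ i j → i ∈ S → j ∈ S → i <ᶠ j → ¬ (f i j ≡ c)

αAtLeast : ∀ {n k} → Coloring n k → Fin k → ℕ → Set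
αAtLeast {n} f c m = Σ (Subset n) λ S → (m ≤ ∣ S ∣) × IsIndependent f c S

Arrows : ∀ {k} → ℕ → Vec ℕ k → Set
Arrows {k} n ms = (f : Coloring n k) → Σ (Fin k) λ i → αAtLeast f i (lookup ms i)

IsCompRamsey : ∀ {k} → Vec ℕ k → ℕ → Set
IsCompRamsey ms n =
  (1 ≤ n) × Arrows n ms × (∀ n′ → 1 ≤ n′ → n′ < n → ¬ Arrows n′ ms)

{-# OPTIONS --safe #-}
module Submission where

-- Lower bounds are explicit colourings, checked by deciding over all vertex subsets.
-- For the upper bounds, a colouring without the required independent sets satisfies clauses
-- "some edge inside S has colour i", one for each i and each set S of m_i vertices.  Sorting the
-- remaining vertices by the colour of their edge to a fixed vertex breaks enough symmetry for
-- a verified backtracking search to refute these clauses, except for m = (4, 4, 4).  There, the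
-- vertices not joined to v in colour l satisfy the constraints with m_l lowered to 3, so
-- there are at most 6 of them, and v has at least 3 neighbours in every colour.  Three neighbours
-- in colour l span both other colours (else, with v, they violate the constraints), so one of these
-- meets an edge of each.  Fixing these 15 edges makes the search small.

open import Defs
open import Data.Bool using (Bool; true; false; T; _∧_; if_then_else_)
open import Data.Bool.ListAction using (all)
open import Data.Bool.Properties using (T-∧; T-≡)
open import Data.Empty using (⊥; ⊥-elim)
open import Data.Fin as Fin using (Fin; zero; suc; toℕ)
import Data.Fin.Properties as Fin
open import Data.Fin.Subset as Subset using (Subset; outside; ∣_∣; ⁅_⁆)
import Data.Fin.Subset.Properties as Subset
open import Data.List as List
  using (List; []; _∷_; [_]; _++_; map; concatMap; length; filter; take; upTo; applyUpTo; allFin; foldr)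
open import Data.List.Membership.Propositional using (_∈_)
import Data.List.Properties as List
open import Data.List.Relation.Binary.Permutation.Propositional using (_↭_; ↭-sym; ↭⇒↭ₛ)
open import Data.List.Relation.Binary.Permutation.Propositional.Properties using (↭-length; All-resp-↭)
import Data.List.Relation.Binary.Permutation.Setoid.Properties as Permutation
import Data.List.Sort as Sort
open import Data.List.Relation.Unary.All as All using (All; []; _∷_)
import Data.List.Relation.Unary.All.Properties as All
open import Data.List.Relation.Unary.AllPairs as AllPairs using (AllPairs; []; _∷_)
import Data.List.Relation.Unary.AllPairs.Properties as AllPairs
open import Data.List.Relation.Unary.Any as Any using (Any; here; there)
import Data.List.Relation.Unary.Any.Properties as Any
open import Data.List.Relation.Unary.Linked using (Linked; []; [-]; _∷_)
open import Data.List.Relation.Unary.Unique.Propositional using (Unique)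
open import Data.List.Relation.Unary.Unique.Propositional.Properties using (allFin⁺)
open import Data.Maybe as Maybe using (Maybe; just; nothing)
import Data.Maybe.Relation.Unary.All as Maybe
open import Data.Nat
import Data.Nat.Properties as ℕ
open import Data.Product using (Σ; _×_; _,_; proj₁; proj₂)
open import Data.Sum using (_⊎_; inj₁; inj₂)
open import Data.Unit using (tt)
open import Data.Vec as Vec using (Vec; []; _∷_; lookup)
import Data.Vec.Properties as Vec
open import Function using (_∘_; _on_; case_of_; Equivalence; id)
import Relation.Binary.Construct.Flip.EqAndOrd as Flip
import Relation.Binary.Construct.On as On
open import Relation.Binary.PropositionalEquality
  using (_≡_; _≢_; refl; sym; trans; cong; cong₂; subst; setoid)
open import Relation.Nullary
open import Relation.Nullary.Decidable using (False; toWitnessFalse; decidable-stable; _→-dec_; _×-dec_; ¬?)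
open import Relation.Unary using (U)

-- A refutation procedure for clause sets

-- Edges act as multi-valued variables: making a literal true falsifies those that give the same
-- edge another colour.
record Literal : Set where
  constructor lit
  field
    row column colour : ℕ

Clause : Set
Clause = List Literal

Holds : (ℕ → ℕ → ℕ) → Literal → Set
Holds σ (lit x y a) = σ x y ≡ a

Satisfies : (ℕ → ℕ → ℕ) → List Clause → Set
Satisfies σ = All (Any (Holds σ))

retain : Literal → Maybe Clause → Maybe Clause
retain ℓ nothing  = nothing
retain ℓ (just K) = just (ℓ ∷ K)

-- nothing means that the clause has become true.
reduce : Literal → Clause → Maybe Clause
reduce _ [] = just []
reduce ℓ@(lit x y a) (m@(lit x′ y′ b) ∷ K) =
  if (x ≡ᵇ x′) ∧ (y ≡ᵇ y′)
  then (if a ≡ᵇ b then nothing else reduce ℓ K)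
  else retain m (reduce ℓ K)

assign : Literal → List Clause → List Clause
assign-step : Literal → Maybe Clause → List Clause → List Clause
assign ℓ []       = []
assign ℓ (K ∷ Ks) = assign-step ℓ (reduce ℓ K) Ks
assign-step ℓ nothing  Ks = assign ℓ Ks
assign-step ℓ (just K) Ks = K ∷ assign ℓ Ks

shorter : Clause → Clause → Bool
shorter _       []      = false
shorter []      (_ ∷ _) = true
shorter (_ ∷ K) (_ ∷ L) = shorter K L

shortest : Clause → List Clause → Clause
-- An empty clause stops the scan; `refute` then has no branch left to explore and succeeds.
shortest []        _        = []
shortest K@(_ ∷ _) []       = K
shortest K@(_ ∷ _) (L ∷ Ks) = if shorter L K then shortest L Ks else shortest K Ks

-- Branching on a shortest clause makes unit propagation implicit.
refute : ℕ → List Clause → Bool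
refute zero       _        = false
refute (suc fuel) []       = false
refute (suc fuel) (K ∷ Ks) = all (λ ℓ → refute fuel (assign ℓ (K ∷ Ks))) (shortest K Ks)

module _ {σ : ℕ → ℕ → ℕ} where

  retain-sound : ∀ {m r} → Maybe.All (Any (Holds σ)) r → Maybe.All (Any (Holds σ)) (retain m r)
  retain-sound Maybe.nothing  = Maybe.nothing
  retain-sound (Maybe.just p) = Maybe.just (there p)

  retain-here : ∀ {m} r → Holds σ m → Maybe.All (Any (Holds σ)) (retain m r)
  retain-here nothing  p = Maybe.nothing
  retain-here (just _) p = Maybe.just (here p)

  reduce-sound : ∀ {ℓ} K → Holds σ ℓ → Any (Holds σ) K → Maybe.All (Any (Holds σ)) (reduce ℓ K)
  reduce-sound {lit x y a} (lit x′ y′ b ∷ K) h p with (x ≡ᵇ x′) ∧ (y ≡ᵇ y′) in same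
  reduce-sound {lit x y a} (m ∷ K) h (here p)  | false = retain-here (reduce (lit x y a) K) p
  reduce-sound {lit x y a} (m ∷ K) h (there p) | false = retain-sound (reduce-sound K h p)
  ... | true with a ≡ᵇ b in agree
  ...   | true = Maybe.nothing
  ...   | false with p
  ...     | there p′ = reduce-sound K h p′
  -- The deleted literal cannot be the true one: its edge would have both colours `a` and `b`.
  ...     | here σ≡b = ⊥-elim (subst T agree (ℕ.≡⇒≡ᵇ a b (trans (sym h) (trans (cong₂ σ x≡x′ y≡y′) σ≡b))))
    where
    both = Equivalence.to T-∧ (subst T (sym same) tt)
    x≡x′ = ℕ.≡ᵇ⇒≡ x x′ (proj₁ both)
    y≡y′ = ℕ.≡ᵇ⇒≡ y y′ (proj₂ both)

  assign-sound : ∀ {ℓ Ks} → Holds σ ℓ → Satisfies σ Ks → Satisfies σ (assign ℓ Ks)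
  assign-sound {ℓ} {[]} h [] = []
  assign-sound {ℓ} {K ∷ _} h (p ∷ ps) with reduce ℓ K | reduce-sound K h p
  ... | nothing | _            = assign-sound h ps
  ... | just _  | Maybe.just q = q ∷ assign-sound h ps

  shortest-sound : ∀ K Ks → Satisfies σ (K ∷ Ks) → Any (Holds σ) (shortest K Ks)
  shortest-sound []        Ks       (() ∷ _)
  shortest-sound K@(_ ∷ _) []       (p ∷ []) = p
  shortest-sound K@(_ ∷ _) (L ∷ Ks) (p ∷ q ∷ ps) with shorter L K
  ... | true  = shortest-sound L Ks (q ∷ ps)
  ... | false = shortest-sound K Ks (p ∷ ps)

  -- If the clauses held, some literal of the shortest one would be true, and its branch refutes
  -- clauses that still hold. Running out of fuel yields `false`, so it never counts as a
  -- refutation.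
  refute-sound : ∀ fuel Ks → refute fuel Ks ≡ true → ¬ Satisfies σ Ks
  refute-sound (suc fuel) (K ∷ Ks) r ps = All.All¬⇒¬Any refuted (shortest-sound K Ks ps)
    where
    refuted = All.map (λ {ℓ} r′ h → refute-sound fuel (assign ℓ (K ∷ Ks)) (Equivalence.to T-≡ r′) (assign-sound h ps))
      (All.all⁺ (λ ℓ → refute fuel (assign ℓ (K ∷ Ks))) (shortest K Ks) (Equivalence.from T-≡ r))

-- Pairs and subsequences of a list

module _ {A : Set} where

  pairs : List A → List (A × A)
  pairs []       = []
  pairs (x ∷ xs) = map (x ,_) xs ++ pairs xs

  choose : ℕ → List A → List (List A)
  choose zero    _        = [ [] ]
  choose (suc m) []       = []
  choose (suc m) (x ∷ xs) = map (x ∷_) (choose m xs) ++ choose (suc m) xs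

  pairs⁻ : ∀ {R : A → A → Set} xs → All (λ (x , y) → R x y) (pairs xs) → AllPairs R xs
  pairs⁻ []       _  = []
  pairs⁻ (x ∷ xs) ps with p , q ← All.++⁻ (map (x ,_) xs) ps = All.map⁻ p ∷ pairs⁻ xs q

  choose-length : ∀ m xs → All (λ ys → length ys ≡ m) (choose m xs)
  choose-length zero    _        = refl ∷ []
  choose-length (suc m) []       = []
  choose-length (suc m) (x ∷ xs) =
    All.++⁺ (All.map⁺ (All.map (cong suc) (choose-length m xs))) (choose-length (suc m) xs)

  choose-All : ∀ {P : A → Set} m {xs} → All P xs → All (All P) (choose m xs)
  choose-All zero    _        = [] ∷ []
  choose-All (suc m) []       = []
  choose-All (suc m) (p ∷ ps) =
    All.++⁺ (All.map⁺ (All.map (p ∷_) (choose-All m ps))) (choose-All (suc m) ps)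

  choose-AllPairs : ∀ {R : A → A → Set} m {xs} → AllPairs R xs → All (AllPairs R) (choose m xs)
  choose-AllPairs zero    _        = [] ∷ []
  choose-AllPairs (suc m) []       = []
  choose-AllPairs (suc m) (p ∷ ps) = All.++⁺
    (All.map⁺ (All.map (λ (q , qs) → q ∷ qs) (All.zip (choose-All m p , choose-AllPairs m ps))))
    (choose-AllPairs (suc m) ps)

-- Positions past the end of the list are sent to the default d.
nth : {A : Set} → A → List A → ℕ → A
nth d []       _       = d
nth d (x ∷ xs) zero    = x
nth d (x ∷ xs) (suc j) = nth d xs j

-- Used to pull facts about the entries of a list back to its positions, which are what clauses
-- mention.
nth-upTo : ∀ {A : Set} (d : A) xs → map (nth d xs) (upTo (length xs)) ≡ xs
nth-upTo d xs = trans (List.map-upTo (nth d xs) (length xs)) (go xs)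
  where
  go : ∀ xs → applyUpTo (nth d xs) (length xs) ≡ xs
  go []       = refl
  go (x ∷ xs) = cong (x ∷_) (go xs)

nth-Linked : ∀ {A : Set} {R : A → A → Set} (d : A) {xs} → Linked R xs →
             ∀ {j} → suc j < length xs → R (nth d xs j) (nth d xs (suc j))
nth-Linked d (r ∷ _)  {zero}  _         = r
nth-Linked d (_ ∷ rs) {suc j} (s≤s j<n) = nth-Linked d rs j<n
nth-Linked d [-]      {zero}  (s≤s ())
nth-Linked d [-]      {suc _} (s≤s ())

-- Colourings as valuations

paletteClauses : ℕ → ℕ → List Clause
paletteClauses k n = map (λ (x , y) → map (lit x y) (upTo k)) (pairs (upTo n))

colourClauses : ℕ → ℕ → ℕ → List Clause
colourClauses n a m = map (λ S → map (λ (x , y) → lit x y a) (pairs S)) (choose m (upTo n))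

constraints : ∀ {k} → ℕ → Vec ℕ k → List Clause
constraints {k} n ms =
  paletteClauses k n ++ concatMap (λ i → colourClauses n (toℕ i) (lookup ms i)) (allFin k)

-- The colours of the edges from 0 to 1, …, n - 1 form a nonincreasing sequence:
-- for each threshold suc t, one of two consecutive colours is on the right side of it.
sortClauses : ℕ → ℕ → List Clause
sortClauses k n = concatMap
  (λ j → map (λ t → map (lit 0 (2+ j)) (upTo (suc t)) ++ map (lit 0 (suc j)) (applyUpTo (suc t +_) (k ∸ suc t)))
             (upTo (k ∸ 1)))
  (upTo (n ∸ 2))

-- Each assignment removes one edge from all clauses, so for positive `n` a branch has fewer than
-- `n * n` steps.
sortedSearch : ∀ {k} → ℕ → Vec ℕ k → Bool
sortedSearch {k} n ms = refute (n * n) (sortClauses k n ++ constraints n ms)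

-- Soundness of the searches

module _ {V : Set} {k : ℕ} (χ : V → V → Fin k) where

  Avoids : Fin k → List V → Set
  Avoids i = AllPairs (λ x y → χ x y ≢ i)

  -- Counterexamples to arrowing, relative to `P` so that the searches also apply to the
  -- non-neighbours of a vertex. Lists in every order are covered, so vertices may be rearranged
  -- freely.
  Good : (V → Set) → Vec ℕ k → Set
  Good P ms = ∀ i ys → Unique ys → All P ys → length ys ≡ lookup ms i → ¬ Avoids i ys

  valuation : V → List V → ℕ → ℕ → ℕ
  valuation d ws x y = toℕ (χ (nth d ws x) (nth d ws y))

  module _ (d : V) (ws : List V) where

    private
      σ = valuation d ws
      n = length ws

    palette-holds : Satisfies σ (paletteClauses k n)
    palette-holds = All.map⁺ (All.universal (λ (x , y) →
      Any.map⁺ (Any.applyUpTo⁺ id refl (Fin.toℕ<n (χ (nth d ws x) (nth d ws y))))) (pairs (upTo n)))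

    -- If a clause failed, the vertices at the positions in `S` would form a list of the forbidden
    -- length that avoids colour `i`.
    colour-holds : ∀ {P} ms → Unique ws → All P ws → Good P ms →
                   ∀ i → Satisfies σ (colourClauses n (toℕ i) (lookup ms i))
    colour-holds {P} ms u p good i = All.map⁺ (All.zipWith clause
      ( choose-length m (upTo n)
      , All.zip ( choose-AllPairs m (AllPairs.map⁻ (subst Unique (sym (nth-upTo d ws)) u))
                , choose-All m (All.map⁻ (subst (All P) (sym (nth-upTo d ws)) p)))))
      where
      m = lookup ms i
      edge : ℕ × ℕ → Literal
      edge (x , y) = lit x y (toℕ i)
      clause : ∀ {S} → length S ≡ m × AllPairs (_≢_ on nth d ws) S × All (P ∘ nth d ws) S →
               Any (Holds σ) (map edge (pairs S))
      clause {S} (len , u′ , p′) = decidable-stable (Any.any? (λ _ → _ ≟ _) _) λ none →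
        good i (map (nth d ws) S) (AllPairs.map⁺ u′) (All.map⁺ p′)
          (trans (List.length-map (nth d ws) S) len)
          (AllPairs.map⁺ (AllPairs.map (_∘ cong toℕ)
            (pairs⁻ S (All.map⁻ (All.¬Any⇒All¬ (map edge (pairs S)) none)))))

    constraints-hold : ∀ {P} ms → Unique ws → All P ws → Good P ms → Satisfies σ (constraints n ms)
    constraints-hold ms u p good = All.++⁺ palette-holds
      (All.concat⁺ (All.map⁺ (All.universal (colour-holds ms u p good) (allFin k))))

  -- The hints are extra clauses made true by a suitable ordering of the vertices; symmetry breaking
  -- enters through them.
  hintedSearch-sound : ∀ {P} fuel hints n ms d ws → refute fuel (hints ++ constraints n ms) ≡ true →
                       length ws ≡ n → Satisfies (valuation d ws) hints →
                       Unique ws → All P ws → ¬ Good P ms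
  hintedSearch-sound fuel hints _ ms d ws found refl hold u p good =
    refute-sound fuel (hints ++ constraints (length ws) ms) found
      (All.++⁺ hold (constraints-hold d ws ms u p good))

  sort-holds : ∀ v vs → Linked (λ x y → toℕ (χ v y) ≤ toℕ (χ v x)) vs →
               Satisfies (valuation v (v ∷ vs)) (sortClauses k (suc (length vs)))
  sort-holds v vs sorted = All.concat⁺ (All.map⁺ (All.applyUpTo⁺₁ id _ λ {j} j< →
    All.map⁺ (All.applyUpTo⁺₂ id (k ∸ 1) (clause j (index (length vs) j<)))))
    where
    σ = valuation v (v ∷ vs)
    -- Entries `j` and `suc j` of `vs` sit at positions `suc j` and `2+ j` of `v ∷ vs`, so `j`
    -- ranges below `length vs ∸ 1`.
    index : ∀ {j} m → j < m ∸ 1 → suc j < m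
    index (suc m) = s<s
    clause : ∀ j → suc j < length vs → ∀ t →
      Any (Holds σ) (map (lit 0 (2+ j)) (upTo (suc t)) ++ map (lit 0 (suc j)) (applyUpTo (suc t +_) (k ∸ suc t)))
    clause j j< t with σ 0 (2+ j) <? suc t
    ... | yes s<t = Any.++⁺ˡ (Any.map⁺ (Any.applyUpTo⁺ id refl s<t))
    ... | no  s≮t = Any.++⁺ʳ (map (lit 0 (2+ j)) (upTo (suc t))) (Any.map⁺ (Any.applyUpTo⁺ (suc t +_)
      (sym (ℕ.m+[n∸m]≡n t≤s)) (ℕ.∸-monoˡ-< (Fin.toℕ<n (χ v (nth v vs j))) t≤s)))
      where
      t≤s : suc t ≤ σ 0 (suc j)
      t≤s = ℕ.≤-trans (ℕ.≮⇒≥ s≮t) (nth-Linked v sorted j<)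

  -- The order is flipped so that sorting puts larger colours first, as `sortClauses` demands.
  colourOrder : V → _
  colourOrder v = On.decTotalOrder (Flip.decTotalOrder ℕ.≤-decTotalOrder) (toℕ ∘ χ v)

  sortedSearch-sound : ∀ {P} n ms ws → sortedSearch (suc n) ms ≡ true → length ws ≡ suc n →
                       Unique ws → All P ws → ¬ Good P ms
  sortedSearch-sound {P} n ms (v ∷ vs) found len (v∉vs ∷ u) (pv ∷ p) good =
    hintedSearch-sound (suc n * suc n) (sortClauses k (suc n)) (suc n) ms v (v ∷ ws) found len′
      (subst (λ l → Satisfies (valuation v (v ∷ ws)) (sortClauses k l)) len′ (sort-holds v ws (sort-↗ vs)))
      (All-resp-↭ vs↭ws v∉vs ∷ Permutation.Unique-resp-↭ (setoid V) (↭⇒↭ₛ vs↭ws) u)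
      (pv ∷ All-resp-↭ vs↭ws p) good
    where
    open Sort (colourOrder v) using (sort; sort-↭; sort-↗)
    ws = sort vs
    vs↭ws : vs ↭ ws
    vs↭ws = ↭-sym (sort-↭ vs)
    len′ : suc (length ws) ≡ suc n
    len′ = trans (cong suc (↭-length (sort-↭ vs))) len

-- From lists of vertices to subsets

module _ {n : ℕ} where

  fromList : List (Fin n) → Subset n
  fromList = foldr (λ x S → ⁅ x ⁆ Subset.∪ S) Subset.⊥

  ∈-fromList⁻ : ∀ {x} ys → x Subset.∈ fromList ys → x ∈ ys
  ∈-fromList⁻ []       x∈ = ⊥-elim (Subset.∉⊥ x∈)
  ∈-fromList⁻ (y ∷ ys) x∈ with Subset.x∈p∪q⁻ ⁅ y ⁆ (fromList ys) x∈
  ... | inj₁ x∈y  = here (Subset.x∈⁅y⁆⇒x≡y y x∈y)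
  ... | inj₂ x∈ys = there (∈-fromList⁻ ys x∈ys)

  ∈-fromList⁺ : ∀ ys → All (Subset._∈ fromList ys) ys
  ∈-fromList⁺ []       = []
  ∈-fromList⁺ (y ∷ ys) = Subset.x∈p∪q⁺ (inj₁ (Subset.x∈⁅x⁆ y))
    ∷ All.map (Subset.x∈p∪q⁺ ∘ inj₂) (∈-fromList⁺ ys)

  -- Induction on the list, deleting its head from `S`.
  Unique⇒length≤∣S∣ : ∀ {ys} {S : Subset n} → Unique ys → All (Subset._∈ S) ys → length ys ≤ ∣ S ∣
  Unique⇒length≤∣S∣ []         _           = z≤n
  Unique⇒length≤∣S∣ (y∉ys ∷ u) (y∈S ∷ ys⊆S) = ℕ.≤-<-trans
    (Unique⇒length≤∣S∣ u (All.zipWith (λ (y≢x , x∈S) → Subset.x∈p∧x≢y⇒x∈p-y x∈S (y≢x ∘ sym)) (y∉ys , ys⊆S)))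
    (Subset.x∈p⇒∣p-x∣<∣p∣ y∈S)

AllPairs-lookup : ∀ {A : Set} {R : A → A → Set} {xs x y} → (∀ {x y} → R x y → R y x) →
                  AllPairs R xs → x ∈ xs → y ∈ xs → x ≢ y → R x y
AllPairs-lookup s (r ∷ rs) (here refl) (here refl) x≢y = ⊥-elim (x≢y refl)
AllPairs-lookup s (r ∷ rs) (here refl) (there y∈)  x≢y = All.lookup r y∈
AllPairs-lookup s (r ∷ rs) (there x∈)  (here refl) x≢y = s (All.lookup r x∈)
AllPairs-lookup s (r ∷ rs) (there x∈)  (there y∈)  x≢y = AllPairs-lookup s rs x∈ y∈ x≢y

-- Symmetrised colourings and the decidability of arrowing

module _ {n k : ℕ} (f : Coloring n k) where

  -- Reflecting the values above the diagonal lets vertex lists be read in any order.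
  symmetrise : Coloring n k
  symmetrise x y with x Fin.<? y
  ... | yes _ = f x y
  ... | no  _ = f y x

  symmetrise-< : ∀ {x y} → x Fin.< y → symmetrise x y ≡ f x y
  symmetrise-< {x} {y} x<y with x Fin.<? y
  ... | yes _   = refl
  ... | no  x≮y = contradiction x<y x≮y

  symmetrise-sym : ∀ x y → symmetrise x y ≡ symmetrise y x
  symmetrise-sym x y with x Fin.<? y | y Fin.<? x
  ... | yes x<y | yes y<x = contradiction y<x (Fin.<-asym x<y)
  ... | yes _   | no  _   = refl
  ... | no  _   | yes _   = refl
  ... | no  x≮y | no  y≮x with refl ← Fin.toℕ-injective (ℕ.≤-antisym (ℕ.≮⇒≥ y≮x) (ℕ.≮⇒≥ x≮y)) = refl

  αAtLeast? : ∀ c m → Dec (αAtLeast f c m)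
  αAtLeast? c m = Subset.anySubset? λ S → (m ≤? ∣ S ∣) ×-dec
    Fin.all? λ i → Fin.all? λ j →
      (i Subset.∈? S) →-dec (j Subset.∈? S) →-dec (i Fin.<? j) →-dec ¬? (f i j Fin.≟ c)

  arrow? : ∀ ms → Dec (Σ (Fin k) λ i → αAtLeast f i (lookup ms i))
  arrow? ms = Fin.any? λ i → αAtLeast? i (lookup ms i)

  Avoids⇒αAtLeast : ∀ {c ys} → Unique ys → Avoids symmetrise c ys → αAtLeast f c (length ys)
  Avoids⇒αAtLeast {c} {ys} u avoids =
    fromList ys , Unique⇒length≤∣S∣ u (∈-fromList⁺ ys) ,
    λ i j i∈ j∈ i<j fij≡c →
      AllPairs-lookup (λ {x} {y} → subst (_≢ c) (symmetrise-sym x y)) avoids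
        (∈-fromList⁻ ys i∈) (∈-fromList⁻ ys j∈) (Fin.<⇒≢ i<j) (trans (symmetrise-< i<j) fij≡c)

-- Arrow relations from searches, monotonicity and merging

-- For a fixed colouring the conclusion is decidable, so a proof by contradiction suffices.
¬Good⇒Arrows : ∀ {k n} (ms : Vec ℕ k) →
  (∀ (χ : Coloring n k) → (∀ x y → χ x y ≡ χ y x) → ¬ Good χ U ms) → Arrows n ms
¬Good⇒Arrows ms ¬good f = decidable-stable (arrow? f ms) λ none →
  ¬good (symmetrise f) (symmetrise-sym f) λ i ys u _ len avoids →
    none (i , subst (αAtLeast f i) len (Avoids⇒αAtLeast f u avoids))

sortedSearch⇒Arrows : ∀ {k} n (ms : Vec ℕ k) → sortedSearch (suc n) ms ≡ true → Arrows (suc n) ms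
sortedSearch⇒Arrows n ms found = ¬Good⇒Arrows ms λ χ _ → sortedSearch-sound χ n ms (allFin (suc n))
  found (List.length-tabulate id) (allFin⁺ (suc n)) (All.universal _ _)

Arrows-suc : ∀ {k n} (ms : Vec ℕ k) → Arrows n ms → Arrows (suc n) ms
Arrows-suc ms arrows f with i , S , m≤ , indep ← arrows (λ x y → f (suc x) (suc y)) =
  i , outside ∷ S , m≤ , λ where
    (suc x) (suc y) x∈ y∈ (s<s x<y) → indep x y (Subset.drop-there x∈) (Subset.drop-there y∈) x<y

Arrows-mono-n : ∀ {k n n′} (ms : Vec ℕ k) → n ≤′ n′ → Arrows n ms → Arrows n′ ms
Arrows-mono-n ms ≤′-refl        = id
Arrows-mono-n ms (≤′-step n≤n′) = Arrows-suc ms ∘ Arrows-mono-n ms n≤n′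

-- Merging colours 0 and 1 turns a colour-0-free set into one free of both.
Arrows-split : ∀ {n} a {b c} → Arrows n (b ∷ c ∷ []) → Arrows n (a ∷ b ∷ c ∷ [])
Arrows-split a arrows f = case arrows (λ x y → merge (f x y)) of λ where
    (zero     , S , m≤ , indep) → suc zero , S , m≤ , λ i j i∈ j∈ i<j → indep i j i∈ j∈ i<j ∘ cong merge
    (suc zero , S , m≤ , indep) → suc (suc zero) , S , m≤ , λ i j i∈ j∈ i<j → indep i j i∈ j∈ i<j ∘ cong merge
  where
  merge : Fin 3 → Fin 2
  merge zero          = zero
  merge (suc zero)    = zero
  merge (suc (suc _)) = suc zero

¬arrow : ∀ {k n} (ms : Vec ℕ k) (f : Coloring n k) → False (arrow? f ms) → ¬ Arrows n ms
¬arrow ms f none arrows = toWitnessFalse none (arrows f)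

-- Arrowing persists when vertices are added, so failure at `n` rules out all smaller values.
isCompRamsey : ∀ {k n} (ms : Vec ℕ k) → Arrows (suc n) ms → ¬ Arrows n ms → IsCompRamsey ms (suc n)
isCompRamsey ms arrows ¬arrows = s≤s z≤n , arrows , λ where
  n′ _ (s≤s n′≤n) arrows′ → ¬arrows (Arrows-mono-n ms (ℕ.≤⇒≤′ n′≤n) arrows′)

-- Ten vertices and m = (4, 4, 4)

ms₄₄₄ : Vec ℕ 3
ms₄₄₄ = 4 ∷ 4 ∷ 4 ∷ []

𝟎 𝟏 𝟐 : Fin 3
𝟎 = zero
𝟏 = suc zero
𝟐 = suc (suc zero)

-- Seven vertices suffice for the parameters 3, 4, 4 in each order; the case `𝟐` also serves for (4,
-- 4, 3).
search-nonneighbours : ∀ l → sortedSearch 7 (ms₄₄₄ Vec.[ l ]≔ 3) ≡ true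
search-nonneighbours zero             = refl
search-nonneighbours (suc zero)       = refl
search-nonneighbours (suc (suc zero)) = refl

fanClauses : ℕ → ℕ → ℕ → ℕ → List Clause
fanClauses x l o o′ =
  [ lit 0 x l ] ∷ [ lit 0 (1 + x) l ] ∷ [ lit 0 (2 + x) l ] ∷
  [ lit x (1 + x) o ] ∷ [ lit x (2 + x) o′ ] ∷ []

-- Position 0 is the centre; positions 1 to 3, 4 to 6 and 7 to 9 are its neighbours in colours 0, 1
-- and 2.
threeFans : List Clause
threeFans = fanClauses 1 0 1 2 ++ fanClauses 4 1 0 2 ++ fanClauses 7 2 0 1

search-threeFans : refute 100 (threeFans ++ constraints 10 ms₄₄₄) ≡ true
search-threeFans = refl

length-filter-∁ : ∀ {A : Set} {P : A → Set} (P? : ∀ x → Dec (P x)) xs →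
                  length (filter P? xs) + length (filter (¬? ∘ P?) xs) ≡ length xs
length-filter-∁ P? []       = refl
length-filter-∁ P? (x ∷ xs) with P? x
... | yes _ = cong suc (length-filter-∁ P? xs)
... | no  _ = trans (ℕ.+-suc _ _) (cong suc (length-filter-∁ P? xs))

record Fan {V : Set} (χ : V → V → Fin 3) (Q : V → Set) (o o′ : Fin 3) : Set where
  constructor fan
  field
    {a b c} : V
    unique  : Unique (a ∷ b ∷ c ∷ [])
    leaves  : All Q (a ∷ b ∷ c ∷ [])
    χab≡o   : χ a b ≡ o
    χac≡o′  : χ a c ≡ o′

  vertices : List V
  vertices = a ∷ b ∷ c ∷ []

module _ {V : Set} (χ : V → V → Fin 3) (χ-sym : ∀ x y → χ x y ≡ χ y x)
         (good : Good χ U ms₄₄₄) where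

  Neighbour : V → Fin 3 → V → Set
  Neighbour v l x = v ≢ x × χ v x ≡ l

  NonNeighbour : V → Fin 3 → V → Set
  NonNeighbour v l x = v ≢ x × χ v x ≢ l

  -- Three non-neighbours without an edge of colour `l` would extend by `v` to four such vertices.
  nonneighbours-good : ∀ v l → Good χ (NonNeighbour v l) (ms₄₄₄ Vec.[ l ]≔ 3)
  nonneighbours-good v l i ys u p len avoids with i Fin.≟ l
  ... | yes refl = good l (v ∷ ys) (All.map proj₁ p ∷ u) (All.universal _ _)
    (trans (cong suc (trans len (Vec.lookup∘updateAt l ms₄₄₄))) (sym (Vec.lookup-replicate l 4)))
    (All.map proj₂ p ∷ avoids)
  ... | no  i≢l  = good i ys u (All.universal _ _) (trans len (Vec.lookup∘updateAt′ i l i≢l ms₄₄₄)) avoids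

  three-fans-impossible : ∀ v → Fan χ (Neighbour v 𝟎) 𝟏 𝟐 → Fan χ (Neighbour v 𝟏) 𝟎 𝟐 →
                          Fan χ (Neighbour v 𝟐) 𝟎 𝟏 → ⊥
  three-fans-impossible v F₀ F₁ F₂ = hintedSearch-sound χ 100 threeFans 10 ms₄₄₄ v ws search-threeFans refl
    (All.++⁺ (hints F₀ refl refl refl)
      (All.++⁺ (hints F₁ refl refl refl) (hints F₂ refl refl refl)))
    ws-unique (All.universal _ ws) good
    where
    open Fan using (vertices; leaves)
    ws : List V
    ws = v ∷ vertices F₀ ++ vertices F₁ ++ vertices F₂
    hints : ∀ {l o o′ x} (F : Fan χ (Neighbour v l) o o′) → nth v ws x ≡ Fan.a F →
            nth v ws (1 + x) ≡ Fan.b F → nth v ws (2 + x) ≡ Fan.c F →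
            Satisfies (valuation χ v ws) (fanClauses x (toℕ l) (toℕ o) (toℕ o′))
    hints {x = x} (fan _ ((_ , p) ∷ (_ , q) ∷ (_ , r) ∷ []) s t) x≡a y≡b z≡c =
      here (edge 0 x refl x≡a p) ∷ here (edge 0 (1 + x) refl y≡b q) ∷ here (edge 0 (2 + x) refl z≡c r) ∷
      here (edge x (1 + x) x≡a y≡b s) ∷ here (edge x (2 + x) x≡a z≡c t) ∷ []
      where
      edge : ∀ i j {y z a} → nth v ws i ≡ y → nth v ws j ≡ z → χ y z ≡ a → valuation χ v ws i j ≡ toℕ a
      edge _ _ i≡y j≡z yz≡a = cong toℕ (trans (cong₂ χ i≡y j≡z) yz≡a)
    apart : ∀ {l l′ xs ys} → l ≢ l′ → All (Neighbour v l) xs → All (Neighbour v l′) ys →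
            All (λ x → All (x ≢_) ys) xs
    apart l≢l′ p q = All.map (λ (_ , x∈l) → All.map (λ (_ , y∈l′) x≡y →
      l≢l′ (trans (sym x∈l) (trans (cong (χ v) x≡y) y∈l′))) q) p
    ws-unique : Unique ws
    ws-unique =
      All.++⁺ (All.map proj₁ (leaves F₀)) (All.++⁺ (All.map proj₁ (leaves F₁)) (All.map proj₁ (leaves F₂)))
      ∷ AllPairs.++⁺ (Fan.unique F₀)
          (AllPairs.++⁺ (Fan.unique F₁) (Fan.unique F₂) (apart (λ ()) (leaves F₁) (leaves F₂)))
          (All.zipWith (λ (p , q) → All.++⁺ p q)
            (apart (λ ()) (leaves F₀) (leaves F₁) , apart (λ ()) (leaves F₀) (leaves F₂)))

  module _ (v : V) (vs : List V) (unique : Unique vs) (v∉vs : All (v ≢_) vs) (9≤∣vs∣ : 9 ≤ length vs) where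

    few-nonneighbours : ∀ l → length (filter (λ x → ¬? (χ v x Fin.≟ l)) vs) ≤ 6
    few-nonneighbours l = ℕ.≮⇒≥ λ 7≤ →
      sortedSearch-sound χ 6 (ms₄₄₄ Vec.[ l ]≔ 3) (take 7 ws)
        (search-nonneighbours l)
        (trans (List.length-take 7 ws) (ℕ.m≤n⇒m⊓n≡m 7≤))
        (AllPairs.take⁺ 7 (AllPairs.filter⁺ P? unique))
        (All.take⁺ 7 (All.zip (All.filter⁺ P? v∉vs , All.all-filter P? vs)))
        (nonneighbours-good v l)
      where
      P? = λ x → ¬? (χ v x Fin.≟ l)
      ws = filter P? vs

    many-neighbours : ∀ l → 3 ≤ length (filter (λ x → χ v x Fin.≟ l) vs)
    many-neighbours l = ℕ.+-cancelʳ-≤ 6 3 _ (begin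
      9                                                      ≤⟨ 9≤∣vs∣ ⟩
      length vs                                              ≡⟨ length-filter-∁ P? vs ⟨
      length (filter P? vs) + length (filter (¬? ∘ P?) vs)   ≤⟨ ℕ.+-monoʳ-≤ _ (few-nonneighbours l) ⟩
      length (filter P? vs) + 6                              ∎)
      where
      open ℕ.≤-Reasoning
      P? = λ x → χ v x Fin.≟ l

    -- Otherwise `v`, `x`, `y`, `z` are four vertices without an edge of colour `o`, since the edges
    -- at `v` have colour `l`.
    colour-in-triangle : ∀ {l o x y z} → o ≢ l → Unique (x ∷ y ∷ z ∷ []) →
      All (Neighbour v l) (x ∷ y ∷ z ∷ []) → χ x y ≡ o ⊎ χ x z ≡ o ⊎ χ y z ≡ o
    colour-in-triangle {l} {o} {x} {y} {z} o≢l u p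
      with χ x y Fin.≟ o | χ x z Fin.≟ o | χ y z Fin.≟ o
    ... | yes xy | _      | _      = inj₁ xy
    ... | no _   | yes xz | _      = inj₂ (inj₁ xz)
    ... | no _   | no _   | yes yz = inj₂ (inj₂ yz)
    ... | no xy  | no xz  | no yz  = ⊥-elim (good o (v ∷ x ∷ y ∷ z ∷ [])
      (All.map proj₁ p ∷ u) (All.universal _ _) (sym (Vec.lookup-replicate o 4))
      (All.map (λ (_ , vx≡l) vx≡o → o≢l (trans (sym vx≡o) vx≡l)) p ∷ (xy ∷ xz ∷ []) ∷ (yz ∷ []) ∷ [] ∷ []))

    -- Two edges of a triangle meet in a vertex, which becomes the first vertex of the fan.
    exists-fan : ∀ l {o o′} → o ≢ l → o′ ≢ l → o ≢ o′ → Fan χ (Neighbour v l) o o′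
    exists-fan l {o} {o′} o≢l o′≢l o≢o′
      with filter P? vs | many-neighbours l | AllPairs.filter⁺ P? unique
         | All.zip (All.filter⁺ P? v∉vs , All.all-filter P? vs)
      where P? = λ x → χ v x Fin.≟ l
    ... | x ∷ y ∷ z ∷ _ | s≤s (s≤s (s≤s _)) | (x≢y ∷ x≢z ∷ _) ∷ (y≢z ∷ _) ∷ _ | px ∷ py ∷ pz ∷ _
      with colour-in-triangle o≢l u p | colour-in-triangle o′≢l u p
      where
      u = (x≢y ∷ x≢z ∷ []) ∷ (y≢z ∷ []) ∷ [] ∷ []
      p = px ∷ py ∷ pz ∷ []
    ... | inj₁ xy        | inj₁ xy′        = ⊥-elim (o≢o′ (trans (sym xy) xy′))
    ... | inj₁ xy        | inj₂ (inj₁ xz)  =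
      fan ((x≢y ∷ x≢z ∷ []) ∷ (y≢z ∷ []) ∷ [] ∷ []) (px ∷ py ∷ pz ∷ []) xy xz
    ... | inj₁ xy        | inj₂ (inj₂ yz)  =
      fan ((x≢y ∘ sym ∷ y≢z ∷ []) ∷ (x≢z ∷ []) ∷ [] ∷ []) (py ∷ px ∷ pz ∷ []) (trans (χ-sym y x) xy) yz
    ... | inj₂ (inj₁ xz) | inj₁ xy         =
      fan ((x≢z ∷ x≢y ∷ []) ∷ (y≢z ∘ sym ∷ []) ∷ [] ∷ []) (px ∷ pz ∷ py ∷ []) xz xy
    ... | inj₂ (inj₁ xz) | inj₂ (inj₁ xz′) = ⊥-elim (o≢o′ (trans (sym xz) xz′))
    ... | inj₂ (inj₁ xz) | inj₂ (inj₂ yz)  =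
      fan ((x≢z ∘ sym ∷ y≢z ∘ sym ∷ []) ∷ (x≢y ∷ []) ∷ [] ∷ []) (pz ∷ px ∷ py ∷ [])
        (trans (χ-sym z x) xz) (trans (χ-sym z y) yz)
    ... | inj₂ (inj₂ yz) | inj₁ xy         =
      fan ((y≢z ∷ x≢y ∘ sym ∷ []) ∷ (x≢z ∘ sym ∷ []) ∷ [] ∷ []) (py ∷ pz ∷ px ∷ []) yz (trans (χ-sym y x) xy)
    ... | inj₂ (inj₂ yz) | inj₂ (inj₁ xz)  =
      fan ((y≢z ∘ sym ∷ x≢z ∘ sym ∷ []) ∷ (x≢y ∘ sym ∷ []) ∷ [] ∷ []) (pz ∷ py ∷ px ∷ [])
        (trans (χ-sym z y) yz) (trans (χ-sym z x) xz)
    ... | inj₂ (inj₂ yz) | inj₂ (inj₂ yz′) = ⊥-elim (o≢o′ (trans (sym yz) yz′))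

    ten-vertices-impossible : ⊥
    ten-vertices-impossible = three-fans-impossible v
      (exists-fan 𝟎 (λ ()) (λ ()) (λ ())) (exists-fan 𝟏 (λ ()) (λ ()) (λ ())) (exists-fan 𝟐 (λ ()) (λ ()) (λ ()))

arrows-444 : Arrows 10 ms₄₄₄
arrows-444 = ¬Good⇒Arrows ms₄₄₄ λ χ χ-sym good →
  case allFin⁺ 10 of λ where
    (v∉vs ∷ unique) → ten-vertices-impossible χ χ-sym good zero _ unique v∉vs ℕ.≤-refl

-- Extremal colourings

fromTable : ∀ {n} → Vec (Vec (Fin 3) n) n → Coloring n 3
fromTable M x y = lookup (lookup M x) y

-- Colours 0 and 1 each contain p disjoint p-cliques, and an independent set of colour 2
-- lies in a row or a column.
grid : ∀ p → Coloring (p * p) 3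
grid p x y =
  if does (Fin.quotient {p} p x Fin.≟ Fin.quotient {p} p y) then 𝟎
  else if does (Fin.remainder {p} p x Fin.≟ Fin.remainder {p} p y) then 𝟏 else 𝟐

-- Colours 1 and 2 are complementary pentagons.
coloring₅ : Coloring 5 3
coloring₅ = fromTable
  ( (𝟎 ∷ 𝟏 ∷ 𝟐 ∷ 𝟐 ∷ 𝟏 ∷ [])
  ∷ (𝟏 ∷ 𝟎 ∷ 𝟏 ∷ 𝟐 ∷ 𝟐 ∷ [])
  ∷ (𝟐 ∷ 𝟏 ∷ 𝟎 ∷ 𝟏 ∷ 𝟐 ∷ [])
  ∷ (𝟐 ∷ 𝟐 ∷ 𝟏 ∷ 𝟎 ∷ 𝟏 ∷ [])
  ∷ (𝟏 ∷ 𝟐 ∷ 𝟐 ∷ 𝟏 ∷ 𝟎 ∷ [])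
  ∷ [])

-- Colour 0 is a hexagon, colour 1 its three long diagonals, and colour 2 the two triangles of short
-- diagonals.
coloring₆ : Coloring 6 3
coloring₆ = fromTable
  ( (𝟎 ∷ 𝟎 ∷ 𝟐 ∷ 𝟏 ∷ 𝟐 ∷ 𝟎 ∷ [])
  ∷ (𝟎 ∷ 𝟎 ∷ 𝟎 ∷ 𝟐 ∷ 𝟏 ∷ 𝟐 ∷ [])
  ∷ (𝟐 ∷ 𝟎 ∷ 𝟎 ∷ 𝟎 ∷ 𝟐 ∷ 𝟏 ∷ [])
  ∷ (𝟏 ∷ 𝟐 ∷ 𝟎 ∷ 𝟎 ∷ 𝟎 ∷ 𝟐 ∷ [])
  ∷ (𝟐 ∷ 𝟏 ∷ 𝟐 ∷ 𝟎 ∷ 𝟎 ∷ 𝟎 ∷ [])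
  ∷ (𝟎 ∷ 𝟐 ∷ 𝟏 ∷ 𝟐 ∷ 𝟎 ∷ 𝟎 ∷ [])
  ∷ [])

-- Colour 1 is the 7-cycle 0, 4, 2, 1, 5, 3, 6 and colour 0 a matching of three chords at cycle
-- distance 3. Together they contain no triangle, so an independent set of colour 2 has at most two
-- vertices.
coloring₇ : Coloring 7 3
coloring₇ = fromTable
  ( (𝟎 ∷ 𝟐 ∷ 𝟐 ∷ 𝟐 ∷ 𝟏 ∷ 𝟐 ∷ 𝟏 ∷ [])
  ∷ (𝟐 ∷ 𝟎 ∷ 𝟏 ∷ 𝟐 ∷ 𝟐 ∷ 𝟏 ∷ 𝟎 ∷ [])
  ∷ (𝟐 ∷ 𝟏 ∷ 𝟎 ∷ 𝟎 ∷ 𝟏 ∷ 𝟐 ∷ 𝟐 ∷ [])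
  ∷ (𝟐 ∷ 𝟐 ∷ 𝟎 ∷ 𝟎 ∷ 𝟐 ∷ 𝟏 ∷ 𝟏 ∷ [])
  ∷ (𝟏 ∷ 𝟐 ∷ 𝟏 ∷ 𝟐 ∷ 𝟎 ∷ 𝟎 ∷ 𝟐 ∷ [])
  ∷ (𝟐 ∷ 𝟏 ∷ 𝟐 ∷ 𝟏 ∷ 𝟎 ∷ 𝟎 ∷ 𝟐 ∷ [])
  ∷ (𝟏 ∷ 𝟎 ∷ 𝟐 ∷ 𝟏 ∷ 𝟐 ∷ 𝟐 ∷ 𝟎 ∷ [])
  ∷ [])

-- The extremal colouring for R(4, 3) = 9, with two of its edges recoloured to 0.
coloring₈ : Coloring 8 3
coloring₈ = fromTable
  ( (𝟎 ∷ 𝟏 ∷ 𝟐 ∷ 𝟐 ∷ 𝟎 ∷ 𝟐 ∷ 𝟐 ∷ 𝟏 ∷ [])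
  ∷ (𝟏 ∷ 𝟎 ∷ 𝟏 ∷ 𝟐 ∷ 𝟐 ∷ 𝟎 ∷ 𝟐 ∷ 𝟐 ∷ [])
  ∷ (𝟐 ∷ 𝟏 ∷ 𝟎 ∷ 𝟏 ∷ 𝟐 ∷ 𝟐 ∷ 𝟏 ∷ 𝟐 ∷ [])
  ∷ (𝟐 ∷ 𝟐 ∷ 𝟏 ∷ 𝟎 ∷ 𝟏 ∷ 𝟐 ∷ 𝟐 ∷ 𝟏 ∷ [])
  ∷ (𝟎 ∷ 𝟐 ∷ 𝟐 ∷ 𝟏 ∷ 𝟎 ∷ 𝟏 ∷ 𝟐 ∷ 𝟐 ∷ [])
  ∷ (𝟐 ∷ 𝟎 ∷ 𝟐 ∷ 𝟐 ∷ 𝟏 ∷ 𝟎 ∷ 𝟏 ∷ 𝟐 ∷ [])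
  ∷ (𝟐 ∷ 𝟐 ∷ 𝟏 ∷ 𝟐 ∷ 𝟐 ∷ 𝟏 ∷ 𝟎 ∷ 𝟏 ∷ [])
  ∷ (𝟏 ∷ 𝟐 ∷ 𝟐 ∷ 𝟏 ∷ 𝟐 ∷ 𝟐 ∷ 𝟏 ∷ 𝟎 ∷ [])
  ∷ [])

-- Bounds for the nine parameter lists

Arrows-mono-head : ∀ {k n a a′} (ms : Vec ℕ k) → a ≤ a′ → Arrows n (a′ ∷ ms) → Arrows n (a ∷ ms)
Arrows-mono-head ms a≤a′ arrows f with arrows f
... | zero  , S , m≤ , indep = zero , S , ℕ.≤-trans a≤a′ m≤ , indep
... | suc i , found          = suc i , found

arrows-533 : Arrows 5 (5 ∷ 3 ∷ 3 ∷ [])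
arrows-533 = sortedSearch⇒Arrows 4 (5 ∷ 3 ∷ 3 ∷ []) refl

-- With two colours, a set independent in one is a clique in the other, so the search proves that
-- the classical R(3, 3) is at most 6. The bound for (7, 4, 3) rests likewise on R(4, 3) being at
-- most 9.
arrows-633 : Arrows 6 (6 ∷ 3 ∷ 3 ∷ [])
arrows-633 = Arrows-split 6 (sortedSearch⇒Arrows 5 (3 ∷ 3 ∷ []) refl)

arrows-443 : Arrows 7 (4 ∷ 4 ∷ 3 ∷ [])
arrows-443 = sortedSearch⇒Arrows 6 (ms₄₄₄ Vec.[ 𝟐 ]≔ 3) (search-nonneighbours 𝟐)

arrows-643 : Arrows 8 (6 ∷ 4 ∷ 3 ∷ [])
arrows-643 = sortedSearch⇒Arrows 7 (6 ∷ 4 ∷ 3 ∷ []) refl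

arrows-743 : Arrows 9 (7 ∷ 4 ∷ 3 ∷ [])
arrows-743 = Arrows-split 7 (sortedSearch⇒Arrows 8 (4 ∷ 3 ∷ []) refl)

¬arrows-333 : ¬ Arrows 4 (3 ∷ 3 ∷ 3 ∷ [])
¬arrows-333 = ¬arrow (3 ∷ 3 ∷ 3 ∷ []) (grid 2) tt

-- No edge has colour 0, so its independence number is 5, still below 6.
¬arrows-633 : ¬ Arrows 5 (6 ∷ 3 ∷ 3 ∷ [])
¬arrows-633 = ¬arrow (6 ∷ 3 ∷ 3 ∷ []) coloring₅ tt

¬arrows-443 : ¬ Arrows 6 (4 ∷ 4 ∷ 3 ∷ [])
¬arrows-443 = ¬arrow (4 ∷ 4 ∷ 3 ∷ []) coloring₆ tt

¬arrows-543 : ¬ Arrows 7 (5 ∷ 4 ∷ 3 ∷ [])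
¬arrows-543 = ¬arrow (5 ∷ 4 ∷ 3 ∷ []) coloring₇ tt

-- The two disjoint edges of colour 0 bring its independence number down from 8 to 6.
¬arrows-743 : ¬ Arrows 8 (7 ∷ 4 ∷ 3 ∷ [])
¬arrows-743 = ¬arrow (7 ∷ 4 ∷ 3 ∷ []) coloring₈ tt

¬arrows-444 : ¬ Arrows 9 ms₄₄₄
¬arrows-444 = ¬arrow ms₄₄₄ (grid 3) tt

theorem6p3 : (IsCompRamsey (3 ∷ 3 ∷ 3 ∷ []) 5 × IsCompRamsey (4 ∷ 3 ∷ 3 ∷ []) 5
    × IsCompRamsey (5 ∷ 3 ∷ 3 ∷ []) 5 × IsCompRamsey (6 ∷ 3 ∷ 3 ∷ []) 6)
    × (IsCompRamsey (4 ∷ 4 ∷ 3 ∷ []) 7 × IsCompRamsey (5 ∷ 4 ∷ 3 ∷ []) 8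
    × IsCompRamsey (6 ∷ 4 ∷ 3 ∷ []) 8 × IsCompRamsey (7 ∷ 4 ∷ 3 ∷ []) 9)
    × IsCompRamsey (4 ∷ 4 ∷ 4 ∷ []) 10
theorem6p3 =
  -- The upper bound for (5, 3, 3) and the lower bound for (3, 3, 3) coincide, so monotonicity in
  -- the first parameter settles all three lists.
  ( isCompRamsey (3 ∷ 3 ∷ 3 ∷ []) (Arrows-mono-head (3 ∷ 3 ∷ []) (ℕ.m≤m+n 3 2) arrows-533) ¬arrows-333
  , isCompRamsey (4 ∷ 3 ∷ 3 ∷ []) (Arrows-mono-head (3 ∷ 3 ∷ []) (ℕ.m≤m+n 4 1) arrows-533)
      (¬arrows-333 ∘ Arrows-mono-head (3 ∷ 3 ∷ []) (ℕ.m≤m+n 3 1))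
  , isCompRamsey (5 ∷ 3 ∷ 3 ∷ []) arrows-533 (¬arrows-333 ∘ Arrows-mono-head (3 ∷ 3 ∷ []) (ℕ.m≤m+n 3 2))
  , isCompRamsey (6 ∷ 3 ∷ 3 ∷ []) arrows-633 ¬arrows-633 ) ,
  ( isCompRamsey (4 ∷ 4 ∷ 3 ∷ []) arrows-443 ¬arrows-443
  , isCompRamsey (5 ∷ 4 ∷ 3 ∷ []) (Arrows-mono-head (4 ∷ 3 ∷ []) (ℕ.m≤m+n 5 1) arrows-643) ¬arrows-543
  , isCompRamsey (6 ∷ 4 ∷ 3 ∷ []) arrows-643 (¬arrows-543 ∘ Arrows-mono-head (4 ∷ 3 ∷ []) (ℕ.m≤m+n 5 1))
  , isCompRamsey (7 ∷ 4 ∷ 3 ∷ []) arrows-743 ¬arrows-743 ) ,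
  isCompRamsey ms₄₄₄ arrows-444 ¬arrows-444
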